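{- Let $G$ be a simple graph of order $n$ and $m\ge 3$. Let $\alpha'(G)$ be the size of a maximum matching $M$ of $G$ and $l=n-2\alpha'(G)$ the number of $M$-unsaturated vertices of $G$. Then $s(G\circ C_m)=n\,s(C_m)+\alpha'(G)+l$ if $m\equiv 0\pmod 3$, and $s(G\circ C_m)=n\,s(C_m)$ otherwise.
   Context: A matching in a graph is a set of edges no two of which share a vertex; it is maximal if it is not properly contained in another matching, and maximum if it has the largest possible size. A vertex is $M$-unsaturated if no edge of $M$ is incident to it. The saturation number $s(G)$ is the minimum cardinality of a maximal matching of $G$. $C_m$ is the cycle on $m$ vertices; $s(C_m)=\lceil m/3\rceil$. The corona $G_1\circ G_2$ is obtained by taking one copy of $G_1$ and $|V(G_1)|$ disjoint copies of $G_2$, and joining the $i$-th vertex of $G_1$ by an edge to every vertex of the $i$-th copy of $G_2$. -}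

module Defs where

open import Data.Nat using (ℕ; zero; suc; _+_; _*_; _≤_; z≤n; s≤s)
import Data.Nat.Properties as ℕ
open import Data.Fin using (Fin; zero; suc; toℕ)
import Data.Fin.Properties as Fin
open import Data.List using (List; []; _∷_; length; map; filter; allFin; lookup; cartesianProduct)
open import Data.List.Relation.Unary.All as All using (All; []; _∷_)
open import Data.List.Relation.Unary.Any as Any using (Any; here; there)
open import Data.List.Relation.Unary.AllPairs as AllPairs using (AllPairs; []; _∷_)
open import Data.List.Membership.Propositional using (_∈_; find; lose)
open import Data.List.Membership.Propositional.Properties using (∈-map⁺; ∈-allFin; ∈-cartesianProduct⁺; ∈-lookup)
open import Data.Product using (_×_; _,_; proj₁; proj₂; ∃; ∃-syntax; uncurry)
open import Data.Product.Function.NonDependent.Propositional using (_×-↔_)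
open import Data.Sum using (_⊎_; inj₁; inj₂; [_,_]′)
open import Data.Sum.Function.Propositional using (_⊎-↔_)
open import Data.Empty using (⊥-elim)
open import Function.Bundles using (_↔_; Inverse)
open import Function.Construct.Identity using (↔-id)
open import Function.Properties.Inverse using (↔-sym; ↔-trans)
open import Relation.Binary.Definitions using (Decidable; DecidableEquality; Symmetric)
open import Relation.Binary.PropositionalEquality using (_≡_; refl; sym; trans; cong; subst)
open import Relation.Nullary using (¬_; Dec; yes; no)
open import Relation.Nullary.Decidable using (map′; _×-dec_; _⊎-dec_; _→-dec_; ¬?)

-- Finite simple graphs; decidability of adjacency is automatic classically.
record SimpleGraph : Set₁ where
  field
    V      : Set
    order  : ℕ
    enum   : V ↔ Fin order
    Adj    : V → V → Set
    adj?   : Decidable Adj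
    symm   : Symmetric Adj
    irrefl : ∀ {v} → ¬ Adj v v

  index : V → Fin order
  index = Inverse.to enum

  vertex : Fin order → V
  vertex = Inverse.from enum

  vertex-index : ∀ v → vertex (index v) ≡ v
  vertex-index = Inverse.strictlyInverseʳ enum

  vertices : List V
  vertices = map vertex (allFin order)

  _≟ᵥ_ : DecidableEquality V
  u ≟ᵥ v = map′ (λ p → trans (sym (vertex-index u)) (trans (cong vertex p) (vertex-index v)))
                (cong index) (index u Fin.≟ index v)

module _ (G : SimpleGraph) where
  open SimpleGraph G

  -- An edge is represented by either of the two orderings of its endpoints.
  Pair : Set
  Pair = V × V

  SameEdge : Pair → Pair → Set
  SameEdge (a , b) (c , d) = (a ≡ c × b ≡ d) ⊎ (a ≡ d × b ≡ c)

  Incident : V → Pair → Set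
  Incident v (a , b) = v ≡ a ⊎ v ≡ b

  ShareVertex : Pair → Pair → Set
  ShareVertex e f = ∃[ v ] (Incident v e × Incident v f)

  _∈ₑ_ : Pair → List Pair → Set
  e ∈ₑ M = Any (SameEdge e) M

  _⊆ₑ_ : List Pair → List Pair → Set
  M ⊆ₑ M′ = ∀ e → e ∈ₑ M → e ∈ₑ M′

  -- The second condition also forbids listing an edge twice (in either
  -- ordering), so the length of a matching is its cardinality.
  IsMatching : List Pair → Set
  IsMatching M = All (uncurry Adj) M × AllPairs (λ e f → ¬ ShareVertex e f) M

  IsMaximalMatching : List Pair → Set
  IsMaximalMatching M =
    IsMatching M × (∀ M′ → IsMatching M′ → M ⊆ₑ M′ → M′ ⊆ₑ M)

  IsMaximumMatching : List Pair → Set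
  IsMaximumMatching M =
    IsMatching M × (∀ M′ → IsMatching M′ → length M′ ≤ length M)

  Saturated : List Pair → V → Set
  Saturated M v = Any (Incident v) M

  Unsaturated : List Pair → V → Set
  Unsaturated M v = ¬ Saturated M v

  incident? : Decidable Incident
  incident? v (a , b) = (v ≟ᵥ a) ⊎-dec (v ≟ᵥ b)

  saturated? : Decidable Saturated
  saturated? M v = Any.any? (incident? v) M

  unsaturatedCount : List Pair → ℕ
  unsaturatedCount M = length (filter (λ v → ¬? (saturated? M v)) vertices)

  IsSaturationNumber : ℕ → Set
  IsSaturationNumber k =
    (∃[ M ] (IsMaximalMatching M × length M ≡ k)) ×
    (∀ M → IsMaximalMatching M → k ≤ length M)

  IsMatchingNumber : ℕ → Set
  IsMatchingNumber k = ∃[ M ] (IsMaximumMatching M × length M ≡ k)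

module _ {P : ℕ → Set} (P? : ∀ k → Dec (P k)) where

  search : ∀ n → (∃[ k ] (P k × (∀ j → P j → k ≤ j))) ⊎ (∀ j → P j → n ≤ j)
  search zero = inj₂ λ _ _ → z≤n
  search (suc n) with search n
  ... | inj₁ r = inj₁ r
  ... | inj₂ h with P? n
  ...   | yes p = inj₁ (n , p , h)
  ...   | no ¬p = inj₂ λ j pj → ℕ.≤∧≢⇒< (h j pj) λ { refl → ¬p pj }

  least : ∃ P → ∃[ k ] (P k × (∀ j → P j → k ≤ j))
  least (n , p) with search (suc n)
  ... | inj₁ r = r
  ... | inj₂ h = ⊥-elim (ℕ.1+n≰n (h n p))

  greatest : ∃ P → ∀ b → (∀ j → P j → j ≤ b) → ∃[ k ] (P k × (∀ j → P j → j ≤ k))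
  greatest (zero , p) zero h = zero , p , h
  greatest (suc n , p) zero h with h (suc n) p
  ... | ()
  greatest w (suc b) h with P? (suc b)
  ... | yes p = suc b , p , h
  ... | no ¬p = greatest w b λ j pj → ℕ.≤-pred (ℕ.≤∧≢⇒< (h j pj) λ { refl → ¬p pj })

module _ (G : SimpleGraph) where
  open SimpleGraph G

  anyV? : {P : V → Set} → (∀ v → Dec (P v)) → Dec (∃ P)
  anyV? {P} P? = map′ (λ (i , p) → vertex i , p)
                      (λ (v , p) → index v , subst P (sym (vertex-index v)) p)
                      (Fin.any? (λ i → P? (vertex i)))

  allV? : {P : V → Set} → (∀ v → Dec (P v)) → Dec (∀ v → P v)
  allV? {P} P? = map′ (λ h v → subst P (vertex-index v) (h (index v)))
                      (λ h i → h (vertex i))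
                      (Fin.all? (λ i → P? (vertex i)))

  anyM? : ∀ k {P : List (Pair G) → Set} → (∀ M → Dec (P M)) →
          Dec (∃[ M ] (P M × length M ≡ k))
  anyM? zero P? = map′ (λ p → [] , p , refl) (λ { ([] , p , _) → p }) (P? [])
  anyM? (suc k) P? =
    map′ (λ { (u , v , M , p , q) → (u , v) ∷ M , p , cong suc q })
         (λ { ((u , v) ∷ M , p , q) → u , v , M , p , ℕ.suc-injective q })
         (anyV? λ u → anyV? λ v → anyM? k λ M → P? ((u , v) ∷ M))

  isMatching? : ∀ M → Dec (IsMatching G M)
  isMatching? M = All.all? (uncurry adj?) M ×-dec
    AllPairs.allPairs? (λ e f → ¬? (anyV? λ v → incident? G v e ×-dec incident? G v f)) M

  Dominating : List (Pair G) → Set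
  Dominating M = ∀ u v → Adj u v → Saturated G M u ⊎ Saturated G M v

  dominating? : ∀ M → Dec (Dominating M)
  dominating? M = allV? λ u → allV? λ v →
    adj? u v →-dec (saturated? G M u ⊎-dec saturated? G M v)

  extend : ∀ {M u v} → IsMatching G M → Adj u v →
           Unsaturated G M u → Unsaturated G M v → IsMatching G ((u , v) ∷ M)
  extend {M} {u} {v} (adj , dis) a ¬u ¬v =
    a ∷ adj , All.tabulate new ∷ dis
    where
    new : ∀ {f} → f ∈ M → ¬ ShareVertex G (u , v) f
    new f∈M (_ , inj₁ refl , i) = ¬u (lose f∈M i)
    new f∈M (_ , inj₂ refl , i) = ¬v (lose f∈M i)

  maximal⇒dominating : ∀ {M} → IsMaximalMatching G M → Dominating M
  maximal⇒dominating {M} (mat , max) u v a with saturated? G M u | saturated? G M v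
  ... | yes s | _     = inj₁ s
  ... | no _  | yes s = inj₂ s
  ... | no ¬u | no ¬v = ⊥-elim (¬u (Any.map at-u uv∈M))
    where
    uv∈M : _∈ₑ_ G (u , v) M
    uv∈M = max ((u , v) ∷ M) (extend mat a ¬u ¬v) (λ _ → there)
               (u , v) (here (inj₁ (refl , refl)))
    at-u : ∀ {f} → SameEdge G (u , v) f → Incident G u f
    at-u (inj₁ (p , _)) = inj₁ p
    at-u (inj₂ (p , _)) = inj₂ p

  ∈-unique : ∀ {M e f} → AllPairs (λ e f → ¬ ShareVertex G e f) M →
             e ∈ M → f ∈ M → ShareVertex G e f → e ≡ f
  ∈-unique _        (here refl) (here refl) _ = refl
  ∈-unique (d ∷ _)  (here refl) (there q)   s = ⊥-elim (All.lookup d q s)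
  ∈-unique (d ∷ _)  (there p)   (here refl) (v , i , j) = ⊥-elim (All.lookup d p (v , j , i))
  ∈-unique (_ ∷ ds) (there p)   (there q)   s = ∈-unique ds p q s

  same-incident : ∀ {v e f} → SameEdge G e f → Incident G v e → Incident G v f
  same-incident (inj₁ (refl , refl)) i = i
  same-incident (inj₂ (refl , refl)) (inj₁ p) = inj₂ p
  same-incident (inj₂ (refl , refl)) (inj₂ p) = inj₁ p

  same-join : ∀ {e f g} → SameEdge G e f → SameEdge G g f → SameEdge G e g
  same-join (inj₁ (refl , refl)) (inj₁ (refl , refl)) = inj₁ (refl , refl)
  same-join (inj₁ (refl , refl)) (inj₂ (refl , refl)) = inj₂ (refl , refl)
  same-join (inj₂ (refl , refl)) (inj₁ (refl , refl)) = inj₂ (refl , refl)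
  same-join (inj₂ (refl , refl)) (inj₂ (refl , refl)) = inj₁ (refl , refl)

  dominating⇒maximal : ∀ {M} → IsMatching G M → Dominating M → IsMaximalMatching G M
  dominating⇒maximal {M} mat dom = mat , max
    where
    max : ∀ M′ → IsMatching G M′ → _⊆ₑ_ G M M′ → _⊆ₑ_ G M′ M
    max M′ (adj′ , dis′) M⊆M′ e e∈M′ with find e∈M′
    ... | f , f∈M′ , e≈f =
      [ conclude (inj₁ refl) , conclude (inj₂ refl) ]′ (dom _ _ (All.lookup adj′ f∈M′))
      where
      conclude : ∀ {v} → Incident G v f → Saturated G M v → _∈ₑ_ G e M
      conclude v∈f s with find s
      ... | g , g∈M , v∈g with find (M⊆M′ g (lose g∈M (inj₁ (refl , refl))))
      ... | h , h∈M′ , g≈h with ∈-unique dis′ f∈M′ h∈M′ (_ , v∈f , same-incident g≈h v∈g)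
      ... | refl = lose g∈M (same-join e≈f g≈h)

  isMaximal? : ∀ M → Dec (IsMaximalMatching G M)
  isMaximal? M = map′ (λ (m , d) → dominating⇒maximal m d)
                      (λ m → proj₁ m , maximal⇒dominating m)
                      (isMatching? M ×-dec dominating? M)

  ∈-vertices : ∀ v → v ∈ vertices
  ∈-vertices v = subst (_∈ vertices) (vertex-index v) (∈-map⁺ vertex (∈-allFin (index v)))

  greedy : ∀ (L : List (Pair G)) → ∃[ M ] (IsMatching G M ×
    (∀ {u v} → (u , v) ∈ L → Adj u v → Saturated G M u ⊎ Saturated G M v))
  greedy [] = [] , ([] , []) , λ ()
  greedy ((u , v) ∷ L) with greedy L
  ... | M , mat , dom with adj? u v | saturated? G M u | saturated? G M v
  ... | no ¬a | _     | _     = M , mat , λ { (here refl) a → ⊥-elim (¬a a) ; (there p) → dom p }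
  ... | yes _ | yes s | _     = M , mat , λ { (here refl) _ → inj₁ s ; (there p) → dom p }
  ... | yes _ | no _  | yes s = M , mat , λ { (here refl) _ → inj₂ s ; (there p) → dom p }
  ... | yes a | no ¬u | no ¬v = (u , v) ∷ M , extend mat a ¬u ¬v , λ
    { (here refl) _ → inj₁ (here (inj₁ refl))
    ; (there p) b → [ (λ s → inj₁ (there s)) , (λ s → inj₂ (there s)) ]′ (dom p b) }

  maximal-exists : ∃[ M ] IsMaximalMatching G M
  maximal-exists with greedy (cartesianProduct vertices vertices)
  ... | M , mat , dom = M , dominating⇒maximal mat λ u v →
    dom (∈-cartesianProduct⁺ (∈-vertices u) (∈-vertices v))

  index-injective : ∀ {u v} → index u ≡ index v → u ≡ v
  index-injective p = trans (sym (vertex-index _)) (trans (cong vertex p) (vertex-index _))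

  proj₁-injective : ∀ {M} → AllPairs (λ e f → ¬ ShareVertex G e f) M → ∀ i j →
    proj₁ (lookup M i) ≡ proj₁ (lookup M j) → i ≡ j
  proj₁-injective (d ∷ ds) zero    zero    p = refl
  proj₁-injective (d ∷ ds) zero    (suc j) p =
    ⊥-elim (All.lookup d (∈-lookup j) (_ , inj₁ refl , inj₁ p))
  proj₁-injective (d ∷ ds) (suc i) zero    p =
    ⊥-elim (All.lookup d (∈-lookup i) (_ , inj₁ refl , inj₁ (sym p)))
  proj₁-injective (d ∷ ds) (suc i) (suc j) p = cong suc (proj₁-injective ds i j p)

  matching-bound : ∀ {M} → IsMatching G M → length M ≤ order
  matching-bound {M} (_ , dis) =
    Fin.injective⇒≤ {f = λ i → index (proj₁ (lookup M i))}
      λ {i} {j} p → proj₁-injective dis i j (index-injective p)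

  abstract
    saturationNumber-exists : ∃[ k ] IsSaturationNumber G k
    saturationNumber-exists
      with least (λ k → anyM? k isMaximal?)
                 (_ , proj₁ maximal-exists , proj₂ maximal-exists , refl)
    ... | k , w , min = k , w , λ M mx → min _ (M , mx , refl)

    matchingNumber-exists : ∃[ k ] IsMatchingNumber G k
    matchingNumber-exists
      with greatest (λ k → anyM? k isMatching?) (0 , [] , ([] , []) , refl)
                    order (λ { _ (_ , mat , refl) → matching-bound mat })
    ... | k , (M , mat , refl) , max =
      k , M , (mat , λ M′ mat′ → max _ (M′ , mat′ , refl)) , refl

s : SimpleGraph → ℕ
s G = proj₁ (saturationNumber-exists G)

s-spec : ∀ G → IsSaturationNumber G (s G)
s-spec G = proj₂ (saturationNumber-exists G)

α′ : SimpleGraph → ℕ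
α′ G = proj₁ (matchingNumber-exists G)

α′-spec : ∀ G → IsMatchingNumber G (α′ G)
α′-spec G = proj₂ (matchingNumber-exists G)

CycleNext : ∀ {m} → Fin m → Fin m → Set
CycleNext {m} i j = toℕ j ≡ suc (toℕ i) ⊎ (suc (toℕ i) ≡ m × toℕ j ≡ 0)

cycle : (m : ℕ) → 3 ≤ m → SimpleGraph
cycle m m≥3 = record
  { V      = Fin m
  ; order  = m
  ; enum   = ↔-id (Fin m)
  ; Adj    = λ i j → CycleNext i j ⊎ CycleNext j i
  ; adj?   = λ i j → next? i j ⊎-dec next? j i
  ; symm   = [ inj₂ , inj₁ ]′
  ; irrefl = [ next-irrefl , next-irrefl ]′
  }
  where
  next? : (i j : Fin m) → Dec (CycleNext i j)
  next? i j = (toℕ j ℕ.≟ suc (toℕ i)) ⊎-dec ((suc (toℕ i) ℕ.≟ m) ×-dec (toℕ j ℕ.≟ 0))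
  next-irrefl : {i : Fin m} → ¬ CycleNext i i
  next-irrefl (inj₁ p) = ℕ.1+n≢n (sym p)
  next-irrefl (inj₂ (p , q)) with subst (3 ≤_) (trans (sym p) (cong suc q)) m≥3
  ... | s≤s ()

-- inj₁ u is the vertex u of G; inj₂ (u , x) is the vertex x of the copy of H
-- attached to u.
CoronaAdj : (G H : SimpleGraph) → let open SimpleGraph in
            V G ⊎ (V G × V H) → V G ⊎ (V G × V H) → Set
CoronaAdj G H (inj₁ u)       (inj₁ w)       = SimpleGraph.Adj G u w
CoronaAdj G H (inj₁ u)       (inj₂ (w , y)) = u ≡ w
CoronaAdj G H (inj₂ (u , x)) (inj₁ w)       = u ≡ w
CoronaAdj G H (inj₂ (u , x)) (inj₂ (w , y)) = u ≡ w × SimpleGraph.Adj H x y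

corona : SimpleGraph → SimpleGraph → SimpleGraph
corona G H = record
  { V      = G.V ⊎ (G.V × H.V)
  ; order  = G.order + G.order * H.order
  ; enum   = ↔-trans (G.enum ⊎-↔ ↔-trans (G.enum ×-↔ H.enum) (↔-sym Fin.*↔×))
                     (↔-sym Fin.+↔⊎)
  ; Adj    = CoronaAdj G H
  ; adj?   = dec
  ; symm   = λ {x} {y} → symmetric x y
  ; irrefl = λ {x} → irreflexive x
  }
  where
  module G = SimpleGraph G
  module H = SimpleGraph H
  dec : Decidable (CoronaAdj G H)
  dec (inj₁ u)       (inj₁ w)       = G.adj? u w
  dec (inj₁ u)       (inj₂ (w , _)) = u G.≟ᵥ w
  dec (inj₂ (u , _)) (inj₁ w)       = u G.≟ᵥ w
  dec (inj₂ (u , x)) (inj₂ (w , y)) = (u G.≟ᵥ w) ×-dec H.adj? x y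
  symmetric : ∀ x y → CoronaAdj G H x y → CoronaAdj G H y x
  symmetric (inj₁ _) (inj₁ _) a       = G.symm a
  symmetric (inj₁ _) (inj₂ _) p       = sym p
  symmetric (inj₂ _) (inj₁ _) p       = sym p
  symmetric (inj₂ _) (inj₂ _) (p , a) = sym p , H.symm a
  irreflexive : ∀ x → ¬ CoronaAdj G H x x
  irreflexive (inj₁ _) a       = G.irrefl a
  irreflexive (inj₂ _) (_ , a) = H.irrefl a

{-# OPTIONS --safe #-}
module Submission where

-- Let t = ⌊m/3⌋ and let N be a maximal matching of the corona. In the block of
-- a vertex u of G, let N have b edges inside the copy of C_m and ℓ edges from u
-- to the copy. A vertex of the copy missed by all of these has its successor
-- covered, and each of the b edges can be responsible for only one such vertex,
-- each of the ℓ links for only one too; hence m ≤ 3b + 2ℓ. If u is not covered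
-- at all, then the copy is perfectly matched, and m ≤ 2b.
-- If 3 ∤ m, this gives b + ℓ ≥ t + 1 = s(C_m) for every u. If m = 3t, it gives
-- b + ℓ ≥ t + 1 unless u is covered by an edge of N inside G, in which case
-- b + ℓ ≥ t; with a ≤ α′ edges of N inside G, the total is at least
-- n (t + 1) − 2a + a ≥ n t + n − α′.
-- Both bounds are attained by placing the edges {3i, 3i + 1}, i < t, in every
-- copy, a matching of G (a maximum one if 3 ∣ m, the empty one otherwise) in
-- the core, and joining each remaining vertex of G to an unmatched vertex of
-- its copy, which for 3 ∤ m is taken to be the vertex 3t.

open import Defs
open import Data.Nat using (ℕ; zero; suc; _+_; _*_; _≤_; _<_; z≤n; s≤s)
open import Data.Nat.DivMod using (_%_; _/_; m≡m%n+[m/n]*n; m%n<n; m*n/n≡m; m<n⇒m/n≡0; m<n⇒m%n≡m; [m+kn]%n≡m%n; +-distrib-/-∣ʳ; _divMod_; result)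
open import Data.Nat.Divisibility using (n∣m*n)
import Data.Nat.Properties as ℕ
open import Data.Nat.Tactic.RingSolver using (solve-∀)
open import Data.Nat.ListAction using (sum)
open import Data.Fin using (Fin; zero; suc; toℕ; fromℕ; fromℕ<; inject₁)
import Data.Fin.Properties as Fin
open import Data.List using (List; []; _∷_; [_]; _++_; length; map; filter; concatMap; allFin; lookup; tabulate)
import Data.List.Properties as List
open import Data.List.Membership.Propositional using (_∈_; find; lose)
open import Data.List.Membership.Propositional.Properties using (∈-map⁺; ∈-++⁺ˡ; ∈-++⁺ʳ; ∈-lookup; ∈-filter⁺; ∈-filter⁻)
open import Data.List.Relation.Binary.Subset.Propositional using (_⊆_)
open import Data.List.Relation.Unary.All as All using (All; []; _∷_)
import Data.List.Relation.Unary.All.Properties as All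
open import Data.List.Relation.Unary.AllPairs as AllPairs using (AllPairs; []; _∷_)
import Data.List.Relation.Unary.AllPairs.Properties as AllPairs
open import Data.List.Relation.Unary.Any as Any using (Any; here; there)
import Data.List.Relation.Unary.Any.Properties as Any
open import Data.List.Relation.Unary.Unique.Propositional using (Unique)
import Data.List.Relation.Unary.Unique.Propositional.Properties as Unique
open import Data.Product using (_×_; _,_; proj₁; proj₂; ∃-syntax; uncurry)
open import Data.Sum using (_⊎_; inj₁; inj₂; [_,_]′)
import Data.Sum as Sum
open import Data.Empty using (⊥; ⊥-elim)
open import Function using (_∘_)
open import Function.Bundles using (Inverse)
open import Relation.Binary.PropositionalEquality using (_≡_; _≢_; refl; sym; trans; cong; cong₂; subst; module ≡-Reasoning)
open import Relation.Nullary using (¬_; Dec; yes; no)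
open import Relation.Nullary.Decidable using (¬?; _×-dec_)
open import Algebra.Properties.CommutativeSemigroup ℕ.+-commutativeSemigroup using (interchange)

-- Counting with finite lists.

indicator : {P : Set} → Dec P → ℕ
indicator (yes _) = 1
indicator (no _)  = 0

module _ {A : Set} where

  Unique-lookup-injective : ∀ {xs : List A} → Unique xs → ∀ i j → lookup xs i ≡ lookup xs j → i ≡ j
  Unique-lookup-injective (_ ∷ _)   zero    zero    _ = refl
  Unique-lookup-injective (x∉ ∷ _)  zero    (suc j) p = ⊥-elim (All.lookup x∉ (∈-lookup j) p)
  Unique-lookup-injective (x∉ ∷ _)  (suc i) zero    p = ⊥-elim (All.lookup x∉ (∈-lookup i) (sym p))
  Unique-lookup-injective (_ ∷ xs!) (suc i) (suc j) p = cong suc (Unique-lookup-injective xs! i j p)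

  -- Pigeonhole: sending a position of `xs` to the position in `ys` where its entry is found is
  -- injective, since equal targets mean equal entries and `xs` has no repetitions.
  Unique-⊆⇒length≤ : ∀ {xs ys : List A} → Unique xs → xs ⊆ ys → length xs ≤ length ys
  Unique-⊆⇒length≤ {xs} {ys} xs! xs⊆ys = Fin.injective⇒≤ {f = f} λ {i} {j} p →
    Unique-lookup-injective xs! i j
      (trans (Any.lookup-index (∈ys i)) (trans (cong (lookup ys) p) (sym (Any.lookup-index (∈ys j)))))
    where
    ∈ys : ∀ i → lookup xs i ∈ ys
    ∈ys i = xs⊆ys (∈-lookup i)
    f : Fin (length xs) → Fin (length ys)
    f i = Any.index (∈ys i)

  length-concatMap : ∀ {B : Set} {f : A → List B} {c} → (∀ x → length (f x) ≡ c) →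
                     ∀ xs → length (concatMap f xs) ≡ length xs * c
  length-concatMap         h []       = refl
  length-concatMap {f = f} h (x ∷ xs) =
    trans (List.length-++ (f x)) (cong₂ _+_ (h x) (length-concatMap h xs))

  sum-map-+ : ∀ (f g : A → ℕ) xs → sum (map (λ x → f x + g x) xs) ≡ sum (map f xs) + sum (map g xs)
  sum-map-+ f g []       = refl
  sum-map-+ f g (x ∷ xs) rewrite sum-map-+ f g xs = interchange (f x) (g x) _ _

  length*≤sum-map : ∀ {f : A → ℕ} {c} → (∀ x → c ≤ f x) → ∀ xs → length xs * c ≤ sum (map f xs)
  length*≤sum-map h []       = z≤n
  length*≤sum-map h (x ∷ xs) = ℕ.+-mono-≤ (h x) (length*≤sum-map h xs)

  sum-map≡0 : ∀ {f : A → ℕ} {xs} → All (λ x → f x ≡ 0) xs → sum (map f xs) ≡ 0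
  sum-map≡0 []       = refl
  sum-map≡0 (p ∷ ps) = cong₂ _+_ p (sum-map≡0 ps)

  -- Only an entry equal to `w` can contribute, and `w` occurs at most once.
  sum-map≤1 : ∀ {f : A → ℕ} {w xs} → Unique xs → (∀ x → f x ≤ 1) → (∀ {x} → x ≢ w → f x ≡ 0) →
              (∀ x → Dec (x ≡ w)) → sum (map f xs) ≤ 1
  sum-map≤1                        []         f≤1 f≡0 _≟w = z≤n
  sum-map≤1 {f} {xs = x ∷ xs} (x∉ ∷ xs!) f≤1 f≡0 _≟w with x ≟w
  ... | yes refl rewrite sum-map≡0 {f} (All.map (λ x≢y → f≡0 (x≢y ∘ sym)) x∉) | ℕ.+-identityʳ (f x) = f≤1 x
  ... | no x≢w  rewrite f≡0 x≢w = sum-map≤1 xs! f≤1 f≡0 _≟w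

  sum-indicator : ∀ {P : A → Set} (P? : ∀ x → Dec (P x)) xs → sum (map (indicator ∘ P?) xs) ≡ length (filter P? xs)
  sum-indicator P? []       = refl
  sum-indicator P? (x ∷ xs) with P? x
  ... | yes _ = cong suc (sum-indicator P? xs)
  ... | no _  = sum-indicator P? xs

  length-filter-¬ : ∀ {P : A → Set} (P? : ∀ x → Dec (P x)) xs →
                    length (filter P? xs) + length (filter (¬? ∘ P?) xs) ≡ length xs
  length-filter-¬ P? []       = refl
  length-filter-¬ P? (x ∷ xs) with P? x
  ... | yes _ = cong suc (length-filter-¬ P? xs)
  ... | no _  = trans (ℕ.+-suc _ _) (cong suc (length-filter-¬ P? xs))

-- Saturated vertices and the saturation number of a graph.

s≡ : ∀ G {k} → (∃[ M ] (IsMaximalMatching G M × length M ≡ k)) →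
     (∀ M → IsMaximalMatching G M → k ≤ length M) → s G ≡ k
s≡ G (M , max , refl) min with s-spec G
... | (N , maxN , eq) , least = ℕ.≤-antisym (least M max) (ℕ.≤-trans (min N maxN) (ℕ.≤-reflexive eq))

module _ (G : SimpleGraph) where
  open SimpleGraph G

  α′≡ : ∀ {M} → IsMaximumMatching G M → α′ G ≡ length M
  α′≡ {M} (mat , max) with α′-spec G
  ... | N , (matN , maxN) , eq = trans (sym eq) (ℕ.≤-antisym (max N matN) (maxN M mat))

  length-vertices : length vertices ≡ order
  length-vertices = trans (List.length-map vertex (allFin order)) (List.length-tabulate (λ i → i))

  vertices-unique : Unique vertices
  vertices-unique = Unique.map⁺ (λ {i} {j} p →
    trans (sym (Inverse.strictlyInverseˡ enum i)) (trans (cong index p) (Inverse.strictlyInverseˡ enum j)))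
    (Unique.allFin⁺ order)

  order≤length : ∀ {xs} → (∀ v → v ∈ xs) → order ≤ length xs
  order≤length all = subst (_≤ _) length-vertices (Unique-⊆⇒length≤ vertices-unique λ {v} _ → all v)

  endpoints : List (Pair G) → List V
  endpoints []            = []
  endpoints ((a , b) ∷ M) = a ∷ b ∷ endpoints M

  length-endpoints : ∀ M → length (endpoints M) ≡ 2 * length M
  length-endpoints []      = refl
  length-endpoints (_ ∷ M) = trans (cong (2 +_) (length-endpoints M)) (sym (ℕ.*-suc 2 (length M)))

  ∈-endpoints⁺ : ∀ {M v} → Saturated G M v → v ∈ endpoints M
  ∈-endpoints⁺ (here (inj₁ p)) = here p
  ∈-endpoints⁺ (here (inj₂ p)) = there (here p)
  ∈-endpoints⁺ (there q)       = there (there (∈-endpoints⁺ q))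

  ∈-endpoints⁻ : ∀ {M v} → v ∈ endpoints M → Saturated G M v
  ∈-endpoints⁻ {_ ∷ _} (here p)          = here (inj₁ p)
  ∈-endpoints⁻ {_ ∷ _} (there (here p))  = here (inj₂ p)
  ∈-endpoints⁻ {_ ∷ _} (there (there q)) = there (∈-endpoints⁻ q)

  -- The two ends of one edge differ by irreflexivity, ends of different edges by disjointness.
  endpoints-unique : ∀ {M} → IsMatching G M → Unique (endpoints M)
  endpoints-unique ([] , []) = []
  endpoints-unique {(a , b) ∷ M} (adj ∷ adjs , d ∷ ds) =
    ((λ { refl → irrefl adj }) ∷ new (inj₁ refl)) ∷ new (inj₂ refl) ∷ endpoints-unique (adjs , ds)
    where
    new : ∀ {v} → Incident G v (a , b) → All (v ≢_) (endpoints M)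
    new i = All.tabulate λ { w∈ refl → let f , f∈M , j = find (∈-endpoints⁻ w∈) in All.lookup d f∈M (_ , i , j) }

  saturatedVertices : List (Pair G) → List V
  saturatedVertices M = filter (saturated? G M) vertices

  saturatedVertices≤ : ∀ M → length (saturatedVertices M) ≤ 2 * length M
  saturatedVertices≤ M = subst (length (saturatedVertices M) ≤_) (length-endpoints M)
    (Unique-⊆⇒length≤ (Unique.filter⁺ (saturated? G M) vertices-unique)
      λ v∈ → ∈-endpoints⁺ (proj₂ (∈-filter⁻ (saturated? G M) {xs = vertices} v∈)))

  -- The endpoints of a matching are distinct and all saturated, which gives the inequality opposite
  -- to `saturatedVertices≤`.
  saturatedVertices≡ : ∀ {M} → IsMatching G M → length (saturatedVertices M) ≡ 2 * length M
  saturatedVertices≡ {M} mat = ℕ.≤-antisym (saturatedVertices≤ M)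
    (subst (_≤ length (saturatedVertices M)) (length-endpoints M)
      (Unique-⊆⇒length≤ (endpoints-unique mat)
        λ v∈ → ∈-filter⁺ (saturated? G M) (∈-vertices G _) (∈-endpoints⁻ v∈)))

  order≡2*length+unsaturated : ∀ {M} → IsMatching G M → order ≡ 2 * length M + unsaturatedCount G M
  order≡2*length+unsaturated {M} mat = sym (trans (cong (_+ unsaturatedCount G M) (sym (saturatedVertices≡ mat)))
    (trans (length-filter-¬ (saturated? G M) vertices) length-vertices))

  -- The defect of `B` is concentrated at `x`: covering `x` by one further edge repairs it.
  NearlyDominating : List (Pair G) → V → Set
  NearlyDominating B x = ∀ u v → Adj u v → (Saturated G B u ⊎ Saturated G B v) ⊎ (u ≡ x ⊎ v ≡ x)

  -- If `x` has an unsaturated neighbour `y`, adding the edge `xy` makes `B` maximal. Otherwise all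
  -- neighbours of `x` are saturated, and `B` is maximal already.
  nearlyDominating⇒s≤ : ∀ {B x} → IsMatching G B → Unsaturated G B x → NearlyDominating B x → s G ≤ suc (length B)
  nearlyDominating⇒s≤ {B} {x} mat ¬x dom with anyV? G (λ y → adj? x y ×-dec ¬? (saturated? G B y))
  ... | yes (y , xy , ¬y) = proj₂ (s-spec G) _ (dominating⇒maximal G (extend G mat xy ¬x ¬y) λ u v uv →
          [ Sum.map there there , Sum.map (here ∘ inj₁) (here ∘ inj₁) ]′ (dom u v uv))
  ... | no ¬∃ = ℕ.m≤n⇒m≤1+n (proj₂ (s-spec G) B (dominating⇒maximal G mat λ u v uv →
          [ (λ sat → sat)
          , [ (λ { refl → inj₂ (saturate uv) }) , (λ { refl → inj₁ (saturate (symm uv)) }) ]′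
          ]′ (dom u v uv)))
    where
    saturate : ∀ {y} → Adj x y → Saturated G B y
    saturate {y} xy with saturated? G B y
    ... | yes sat = sat
    ... | no ¬sat = ⊥-elim (¬∃ (y , xy , ¬sat))

-- The covering bound on a cycle.

prev : ∀ {m} → Fin m → Fin m
prev {suc k} zero    = fromℕ k
prev         (suc i) = inject₁ i

-- Turns the successor relation into a function backwards, so that the predecessors of covered
-- vertices can be listed.
CycleNext⇒prev : ∀ {m} {v w : Fin m} → CycleNext v w → v ≡ prev w
CycleNext⇒prev {suc k} {w = zero}  (inj₂ (p , _)) =
  Fin.toℕ-injective (trans (ℕ.suc-injective p) (sym (Fin.toℕ-fromℕ k)))
CycleNext⇒prev {suc k} {w = suc i} (inj₁ p)       =
  Fin.toℕ-injective (trans (sym (ℕ.suc-injective p)) (sym (Fin.toℕ-inject₁ i)))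

CycleNext-total : ∀ {m} (v : Fin m) → ∃[ w ] CycleNext v w
CycleNext-total {suc k} v with ℕ.m≤n⇒m<n∨m≡n (Fin.toℕ<n v)
... | inj₁ lt = fromℕ< lt , inj₁ (Fin.toℕ-fromℕ< lt)
... | inj₂ eq = zero , inj₂ (eq , refl)

module _ (m : ℕ) (m≥3 : 3 ≤ m) where
  private
    C : SimpleGraph
    C = cycle m m≥3

  open SimpleGraph C using (Adj)

  private
    t : ℕ
    t = m / 3

    m≡ : m ≡ m % 3 + t * 3
    m≡ = m≡m%n+[m/n]*n m 3

    t*3≤m : t * 3 ≤ m
    t*3≤m = subst (t * 3 ≤_) (sym m≡) (ℕ.m≤n+m (t * 3) (m % 3))

    m≤2+t*3 : m ≤ 2 + t * 3
    m≤2+t*3 = subst (_≤ 2 + t * 3) (sym m≡) (ℕ.+-monoˡ-≤ (t * 3) (ℕ.≤-pred (m%n<n m 3)))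

    0<t : 0 < t
    0<t with t | m≤2+t*3
    ... | zero  | m≤2 = ⊥-elim (ℕ.1+n≰n (ℕ.≤-trans m≥3 m≤2))
    ... | suc _ | _   = s≤s z≤n

  -- The predecessor of the endpoint that comes first along the cycle: of the
  -- vertices not covered by the edge, the only one whose successor is covered.
  before : Pair C → Fin m
  before (a , b) with prev a Fin.≟ b
  ... | yes _ = prev b
  ... | no _  = prev a

  -- Of the two ends of `e`, the later one is preceded by the earlier one, which is covered. So an
  -- uncovered `v` can only precede the earlier end.
  ≡before : ∀ {e v w} → uncurry Adj e → ¬ Incident C v e → CycleNext v w → Incident C w e → v ≡ before e
  ≡before {a , b} adj ¬i n i with prev a Fin.≟ b | i | adj
  ... | yes p | inj₁ refl | _         = ⊥-elim (¬i (inj₂ (trans (CycleNext⇒prev n) p)))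
  ... | no _  | inj₁ refl | _         = CycleNext⇒prev n
  ... | yes _ | inj₂ refl | _         = CycleNext⇒prev n
  ... | no _  | inj₂ refl | inj₁ ab   = ⊥-elim (¬i (inj₁ (trans (CycleNext⇒prev n) (sym (CycleNext⇒prev ab)))))
  ... | no ¬p | inj₂ refl | inj₂ ba   = ⊥-elim (¬p (sym (CycleNext⇒prev ba)))

  private
    triple : Pair C → List (Fin m)
    triple e@(a , b) = a ∷ b ∷ before e ∷ []

    incident⇒∈triple : ∀ {v e} → Incident C v e → v ∈ triple e
    incident⇒∈triple (inj₁ p) = here p
    incident⇒∈triple (inj₂ p) = there (here p)

  -- `xs` stands for vertices covered from outside the cycle. An uncovered vertex has a covered
  -- successor, so it is `before` some edge of `B` or the predecessor of a member of `xs`. Hence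
  -- three vertices per edge and two per member of `xs` exhaust the cycle.
  m≤3*length+2*length : ∀ {B xs} → All (uncurry Adj) B →
    (∀ {v w} → CycleNext v w → (Saturated C B v ⊎ v ∈ xs) ⊎ (Saturated C B w ⊎ w ∈ xs)) →
    m ≤ 3 * length B + 2 * length xs
  m≤3*length+2*length {B} {xs} adj dom = ℕ.≤-trans (order≤length C {L} covered) (ℕ.≤-reflexive length-L)
    where
    L : List (Fin m)
    L = concatMap triple B ++ xs ++ map prev xs
    length-L : length L ≡ 3 * length B + 2 * length xs
    length-L = trans (List.length-++ (concatMap triple B)) (cong₂ _+_
      (trans (length-concatMap (λ _ → refl) B) (ℕ.*-comm (length B) 3))
      (trans (List.length-++ xs) (cong (length xs +_) (trans (List.length-map prev xs) (sym (ℕ.+-identityʳ _))))))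
    endpoint : ∀ {v} → Saturated C B v → v ∈ L
    endpoint sat = ∈-++⁺ˡ (Any.concatMap⁺ triple (Any.map incident⇒∈triple sat))
    covered : ∀ v → v ∈ L
    covered v with saturated? C B v
    ... | yes sat = endpoint sat
    ... | no ¬sat with CycleNext-total v
    ...   | w , n with dom n
    ...     | inj₁ (inj₁ sat) = endpoint sat
    ...     | inj₁ (inj₂ v∈) = ∈-++⁺ʳ (concatMap triple B) (∈-++⁺ˡ v∈)
    ...     | inj₂ (inj₂ w∈) = ∈-++⁺ʳ (concatMap triple B) (∈-++⁺ʳ xs
                (subst (_∈ map prev xs) (sym (CycleNext⇒prev n)) (∈-map⁺ prev w∈)))
    ...     | inj₂ (inj₁ sat) with find sat
    ...       | e , e∈B , i = ∈-++⁺ˡ (Any.concatMap⁺ triple (lose e∈B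
                (there (there (here (≡before (All.lookup adj e∈B) (λ j → ¬sat (lose e∈B j)) n i))))))

  m≤2*length : ∀ {B} → (∀ v → Saturated C B v) → m ≤ 2 * length B
  m≤2*length {B} all = subst (m ≤_) (length-endpoints C B) (order≤length C (∈-endpoints⁺ C ∘ all))

  -- The sparse matching of a cycle and its saturation number.

  private
    r+i*3<m : ∀ {r} (i : Fin t) → r < 3 → r + toℕ i * 3 < m
    r+i*3<m {r} i r<3 = ℕ.≤-trans (ℕ.+-monoˡ-≤ (toℕ i * 3) r<3)
      (ℕ.≤-trans (ℕ.*-monoˡ-≤ 3 (Fin.toℕ<n i)) t*3≤m)

    [r+i*3]/3≡i : ∀ {r} i → r < 3 → (r + i * 3) / 3 ≡ i
    [r+i*3]/3≡i {r} i r<3 = trans (+-distrib-/-∣ʳ r (n∣m*n i)) (cong₂ _+_ (m<n⇒m/n≡0 r<3) (m*n/n≡m i 3))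

    [r+i*3]%3≡r : ∀ {r} i → r < 3 → (r + i * 3) % 3 ≡ r
    [r+i*3]%3≡r {r} i r<3 = trans ([m+kn]%n≡m%n r i 3) (m<n⇒m%n≡m r<3)

    sparseEdge : Fin t → Pair C
    sparseEdge i = fromℕ< (r+i*3<m i (s≤s z≤n)) , fromℕ< (r+i*3<m i (s≤s (s≤s z≤n)))

    -- The quotient by 3 identifies the edge, so distinct edges are disjoint; vertices with
    -- remainder 2 or quotient `t` are missed.
    incident-sparseEdge⁻ : ∀ {v i} → Incident C v (sparseEdge i) → toℕ v / 3 ≡ toℕ i × toℕ v % 3 < 2
    incident-sparseEdge⁻ {i = i} (inj₁ refl) rewrite Fin.toℕ-fromℕ< (r+i*3<m i (s≤s z≤n)) =
      [r+i*3]/3≡i (toℕ i) (s≤s z≤n) , subst (_< 2) (sym ([r+i*3]%3≡r (toℕ i) (s≤s z≤n))) (s≤s z≤n)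
    incident-sparseEdge⁻ {i = i} (inj₂ refl) rewrite Fin.toℕ-fromℕ< (r+i*3<m i (s≤s (s≤s z≤n))) =
      [r+i*3]/3≡i (toℕ i) (s≤s (s≤s z≤n)) ,
      subst (_< 2) (sym ([r+i*3]%3≡r (toℕ i) (s≤s (s≤s z≤n)))) (s≤s (s≤s z≤n))

  -- The edges {3i, 3i + 1} with i < m / 3.
  sparse : List (Pair C)
  sparse = tabulate sparseEdge

  sparse-isMatching : IsMatching C sparse
  sparse-isMatching = All.tabulate⁺ adjacent , AllPairs.tabulate⁺ λ { i≢j (v , p , q) →
    i≢j (Fin.toℕ-injective (trans (sym (proj₁ (incident-sparseEdge⁻ p))) (proj₁ (incident-sparseEdge⁻ q)))) }
    where
    adjacent : ∀ i → uncurry Adj (sparseEdge i)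
    adjacent i = inj₁ (inj₁ (trans (Fin.toℕ-fromℕ< (r+i*3<m i (s≤s (s≤s z≤n))))
                                   (cong suc (sym (Fin.toℕ-fromℕ< (r+i*3<m i (s≤s z≤n)))))))

  length-sparse : length sparse ≡ m / 3
  length-sparse = List.length-tabulate sparseEdge

  private
    saturated-sparse⁻ : ∀ {v} → Saturated C sparse v → toℕ v / 3 < t × toℕ v % 3 < 2
    saturated-sparse⁻ sat with Any.tabulate⁻ sat
    ... | i , p with incident-sparseEdge⁻ p
    ...   | q , r<2 = subst (_< t) (sym q) (Fin.toℕ<n i) , r<2

    saturated-sparse⁺ : ∀ {v i} r → r < 2 → i < t → toℕ v ≡ r + i * 3 → Saturated C sparse v
    saturated-sparse⁺ zero _ i<t p = Any.tabulate⁺ (fromℕ< i<t) (inj₁ (Fin.toℕ-injective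
      (trans p (sym (trans (Fin.toℕ-fromℕ< _) (cong (_* 3) (Fin.toℕ-fromℕ< i<t)))))))
    saturated-sparse⁺ (suc zero) _ i<t p = Any.tabulate⁺ (fromℕ< i<t) (inj₂ (Fin.toℕ-injective
      (trans p (sym (trans (Fin.toℕ-fromℕ< _) (cong (λ j → suc (j * 3)) (Fin.toℕ-fromℕ< i<t)))))))
    saturated-sparse⁺ (suc (suc _)) (s≤s (s≤s ()))

    -- Only edges at the vertex `3t` can escape domination; that vertex exists exactly when 3 ∤ m.
    sparse-next : ∀ {v w} → CycleNext v w →
      (Saturated C sparse v ⊎ Saturated C sparse w) ⊎ (toℕ v ≡ t * 3 ⊎ toℕ w ≡ t * 3)
    -- The wrap-around edge ends in 0, which is saturated because `t` is positive.
    sparse-next (inj₂ (_ , w≡0)) = inj₁ (inj₂ (saturated-sparse⁺ 0 (s≤s z≤n) 0<t w≡0))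
    sparse-next {v} {w} (inj₁ w≡1+v) with toℕ v divMod 3
    ... | result q r v≡ with ℕ.<-≤-connex q t
    -- Here `v` is at least `3t`, while `v + 1 = w < m ≤ 3t + 2` forces it to be at most `3t`.
    ...   | inj₂ t≤q = inj₂ (inj₁ (ℕ.≤-antisym
              (ℕ.≤-pred (ℕ.≤-pred (ℕ.≤-trans (s≤s (ℕ.≤-reflexive (sym w≡1+v))) (ℕ.≤-trans (Fin.toℕ<n w) m≤2+t*3))))
              (ℕ.≤-trans (ℕ.*-monoˡ-≤ 3 t≤q) (ℕ.≤-trans (ℕ.m≤n+m (q * 3) (toℕ r)) (ℕ.≤-reflexive (sym v≡))))))
    ...   | inj₁ q<t with r
    ...     | zero           = inj₁ (inj₁ (saturated-sparse⁺ 0 (s≤s z≤n) q<t v≡))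
    ...     | suc zero       = inj₁ (inj₁ (saturated-sparse⁺ 1 (s≤s (s≤s z≤n)) q<t v≡))
    -- `v` is the missed vertex of its triple, so `w = 3(q + 1)` starts the next one: saturated if
    -- that triple is complete, and equal to `3t` otherwise.
    ...     | suc (suc zero) with ℕ.m≤n⇒m<n∨m≡n q<t
    ...       | inj₁ 1+q<t = inj₁ (inj₂ (saturated-sparse⁺ 0 (s≤s z≤n) 1+q<t (trans w≡1+v (cong suc v≡))))
    ...       | inj₂ 1+q≡t = inj₂ (inj₂ (trans w≡1+v (trans (cong suc v≡) (cong (_* 3) 1+q≡t))))

  sparse-dominating : m % 3 ≡ 0 → Dominating C sparse
  sparse-dominating m%3≡0 u v = [ next , Sum.swap ∘ next ]′
    where
    outside : ∀ (v : Fin m) → toℕ v ≢ t * 3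
    outside v p = ℕ.<-irrefl (trans p (sym (trans m≡ (cong (_+ t * 3) m%3≡0)))) (Fin.toℕ<n v)
    next : ∀ {u v} → CycleNext u v → Saturated C sparse u ⊎ Saturated C sparse v
    next n with sparse-next n
    ... | inj₁ sat      = sat
    ... | inj₂ (inj₁ p) = ⊥-elim (outside _ p)
    ... | inj₂ (inj₂ p) = ⊥-elim (outside _ p)

  sparse-unsaturated : ∃[ x ] Unsaturated C sparse x
  -- The vertex 2: saturated vertices have remainder 0 or 1.
  sparse-unsaturated = fromℕ< m≥3 , λ sat → ℕ.<-irrefl refl
    (subst (λ k → k % 3 < 2) (Fin.toℕ-fromℕ< m≥3) (proj₂ (saturated-sparse⁻ sat)))

  sparse-nearlyDominating : m % 3 ≢ 0 → ∃[ x ] (Unsaturated C sparse x × NearlyDominating C sparse x)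
  sparse-nearlyDominating m%3≢0 = x , unsat , λ u v → [ next , Sum.map Sum.swap Sum.swap ∘ next ]′
    where
    t*3<m : t * 3 < m
    t*3<m = subst (t * 3 <_) (sym m≡) (ℕ.+-monoˡ-≤ (t * 3) (ℕ.n≢0⇒n>0 m%3≢0))
    x : Fin m
    x = fromℕ< t*3<m
    unsat : Unsaturated C sparse x
    unsat sat = ℕ.<-irrefl (trans (cong (_/ 3) (Fin.toℕ-fromℕ< t*3<m)) (m*n/n≡m t 3)) (proj₁ (saturated-sparse⁻ sat))
    is-x : ∀ {v : Fin m} → toℕ v ≡ t * 3 → v ≡ x
    is-x p = Fin.toℕ-injective (trans p (sym (Fin.toℕ-fromℕ< t*3<m)))
    next : ∀ {u v} → CycleNext u v → (Saturated C sparse u ⊎ Saturated C sparse v) ⊎ (u ≡ x ⊎ v ≡ x)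
    next n = Sum.map₂ (Sum.map is-x is-x) (sparse-next n)

  -- The covering bound for a smallest maximal matching, with nothing covered from outside.
  m≤3*s : m ≤ 3 * s C
  m≤3*s with s-spec C
  ... | (B , max , eq) , _ = subst (λ k → m ≤ 3 * k) eq (subst (m ≤_) (ℕ.+-identityʳ _)
    (m≤3*length+2*length {B} {[]} (proj₁ (proj₁ max))
      λ n → Sum.map inj₁ inj₁ (maximal⇒dominating C max _ _ (inj₁ n))))

  m%3≡0⇒3*[m/3]≡m : m % 3 ≡ 0 → 3 * (m / 3) ≡ m
  m%3≡0⇒3*[m/3]≡m m%3≡0 = trans (ℕ.*-comm 3 t) (sym (trans m≡ (cong (_+ t * 3) m%3≡0)))

  m%3≡0⇒s≡m/3 : m % 3 ≡ 0 → s C ≡ m / 3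
  m%3≡0⇒s≡m/3 m%3≡0 = ℕ.≤-antisym
    (subst (s C ≤_) length-sparse (proj₂ (s-spec C) sparse (dominating⇒maximal C sparse-isMatching (sparse-dominating m%3≡0))))
    (ℕ.*-cancelˡ-≤ 3 (subst (_≤ 3 * s C) (sym (m%3≡0⇒3*[m/3]≡m m%3≡0)) m≤3*s))

  m%3≢0⇒3*[m/3]<m : m % 3 ≢ 0 → 3 * (m / 3) < m
  m%3≢0⇒3*[m/3]<m m%3≢0 = subst (3 * t <_) (sym m≡)
    (subst (_< m % 3 + t * 3) (ℕ.*-comm t 3) (ℕ.+-monoˡ-≤ (t * 3) (ℕ.n≢0⇒n>0 m%3≢0)))

  -- At most one edge at the vertex `3t` completes `sparse`, and `3t < m ≤ 3s` excludes anything
  -- smaller.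
  m%3≢0⇒s≡1+m/3 : m % 3 ≢ 0 → s C ≡ suc (m / 3)
  m%3≢0⇒s≡1+m/3 m%3≢0 with sparse-nearlyDominating m%3≢0
  ... | x , unsat , dom = ℕ.≤-antisym
    (subst (λ k → s C ≤ suc k) length-sparse (nearlyDominating⇒s≤ C sparse-isMatching unsat dom))
    (ℕ.*-cancelˡ-< 3 t (s C) (ℕ.<-≤-trans (m%3≢0⇒3*[m/3]<m m%3≢0) m≤3*s))

-- Splitting a matching of a corona into core edges, copy edges and links.

when : {P A : Set} → Dec P → A → List A
when (yes _) x = [ x ]
when (no _)  _ = []

∈-when : ∀ {P A : Set} (P? : Dec P) {x : A} → P → x ∈ when P? x
∈-when (yes _) _ = here refl
∈-when (no ¬p) p = ⊥-elim (¬p p)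

length-when≤1 : ∀ {P A : Set} (P? : Dec P) {x : A} → length (when P? x) ≤ 1
length-when≤1 (yes _) = s≤s z≤n
length-when≤1 (no _)  = z≤n

length-when≡0 : ∀ {P A : Set} (P? : Dec P) {x : A} → ¬ P → length (when P? x) ≡ 0
length-when≡0 (yes p) ¬p = ⊥-elim (¬p p)
length-when≡0 (no _)  _  = refl

All-when : ∀ {P A : Set} {Q : A → Set} (P? : Dec P) {x : A} → Q x → All Q (when P? x)
All-when (yes _) q = q ∷ []
All-when (no _)  _ = []

module _ (G H : SimpleGraph) where
  private
    module G = SimpleGraph G
    module H = SimpleGraph H

    K : SimpleGraph
    K = corona G H
    module K = SimpleGraph K

  core : Pair K → List (Pair G)
  core (inj₁ u , inj₁ w) = [ (u , w) ]
  core (inj₁ _ , inj₂ _) = []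
  core (inj₂ _ , _)      = []

  -- Testing the index of the first end suffices for edges, because adjacency forces both ends into
  -- the same copy.
  copy : G.V → Pair K → List (Pair H)
  copy u (inj₁ _       , _)            = []
  copy u (inj₂ _       , inj₁ _)       = []
  copy u (inj₂ (w , x) , inj₂ (_ , y)) = when (u G.≟ᵥ w) (x , y)

  link : G.V → Pair K → List H.V
  link u (inj₁ _       , inj₁ _)       = []
  link u (inj₁ _       , inj₂ (w , x)) = when (u G.≟ᵥ w) x
  link u (inj₂ (w , x) , inj₁ _)       = when (u G.≟ᵥ w) x
  link u (inj₂ _       , inj₂ _)       = []

  coreEdges : List (Pair K) → List (Pair G)
  coreEdges = concatMap core

  copyEdges : G.V → List (Pair K) → List (Pair H)
  copyEdges u = concatMap (copy u)

  links : G.V → List (Pair K) → List H.V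
  links u = concatMap (link u)

  private
    core-⊆ : ∀ e {a b} → (a , b) ∈ core e → e ≡ (inj₁ a , inj₁ b)
    core-⊆ (inj₁ _ , inj₁ _) (here refl) = refl
    core-⊆ (inj₁ _ , inj₂ _) ()
    core-⊆ (inj₂ _ , _)      ()

    incident-inj₁ : ∀ {u : G.V} {e} → Incident G u e → Incident K (inj₁ u) (inj₁ (proj₁ e) , inj₁ (proj₂ e))
    incident-inj₁ = Sum.map (cong inj₁) (cong inj₁)

    core-disjoint : ∀ {e f} → ¬ ShareVertex K e f → All (λ x → All (λ y → ¬ ShareVertex G x y) (core f)) (core e)
    core-disjoint {e} {f} ¬sh = All.tabulate λ x∈ → All.tabulate λ y∈ (v , i , j) →
      ¬sh (inj₁ v , subst (Incident K (inj₁ v)) (sym (core-⊆ e x∈)) (incident-inj₁ i)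
                  , subst (Incident K (inj₁ v)) (sym (core-⊆ f y∈)) (incident-inj₁ j))

    core-singleton : ∀ e → AllPairs (λ x y → ¬ ShareVertex G x y) (core e)
    core-singleton (inj₁ _ , inj₁ _) = [] ∷ []
    core-singleton (inj₁ _ , inj₂ _) = []
    core-singleton (inj₂ _ , _)      = []

    core-adj : ∀ e → uncurry K.Adj e → All (uncurry G.Adj) (core e)
    core-adj (inj₁ _ , inj₁ _) a = a ∷ []
    core-adj (inj₁ _ , inj₂ _) _ = []
    core-adj (inj₂ _ , _)      _ = []

    copy-adj : ∀ u e → uncurry K.Adj e → All (uncurry H.Adj) (copy u e)
    copy-adj u (inj₁ _       , _)            _       = []
    copy-adj u (inj₂ _       , inj₁ _)       _       = []
    copy-adj u (inj₂ (w , _) , inj₂ (_ , _)) (_ , a) = All-when (u G.≟ᵥ w) a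

    -- An edge at a core vertex stays in the core or goes to the vertex's own copy. The second
    -- alternative expresses that `link u e` is nonempty.
    incident-core : ∀ e {u} → uncurry K.Adj e → Incident K (inj₁ u) e →
                    Any (Incident G u) (core e) ⊎ Any (_∈ link u e) H.vertices
    incident-core (inj₁ _ , inj₁ _)       _    (inj₁ refl) = inj₁ (here (inj₁ refl))
    incident-core (inj₁ _ , inj₁ _)       _    (inj₂ refl) = inj₁ (here (inj₂ refl))
    incident-core (inj₁ u , inj₂ (_ , x)) refl (inj₁ refl) = inj₂ (lose (∈-vertices H x) (∈-when (u G.≟ᵥ u) refl))
    incident-core (inj₂ (u , x) , inj₁ _) refl (inj₂ refl) = inj₂ (lose (∈-vertices H x) (∈-when (u G.≟ᵥ u) refl))
    incident-core (inj₁ _ , inj₂ _)       _    (inj₂ ())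
    incident-core (inj₂ _ , inj₁ _)       _    (inj₁ ())
    incident-core (inj₂ _ , inj₂ _)       _    (inj₁ ())
    incident-core (inj₂ _ , inj₂ _)       _    (inj₂ ())

    incident-copy : ∀ e {u x} → uncurry K.Adj e → Incident K (inj₂ (u , x)) e →
                    Any (Incident H x) (copy u e) ⊎ x ∈ link u e
    incident-copy (inj₁ _ , inj₁ _)             _          (inj₁ ())
    incident-copy (inj₁ _ , inj₁ _)             _          (inj₂ ())
    incident-copy (inj₁ _ , inj₂ _)             _          (inj₁ ())
    incident-copy (inj₂ _ , inj₁ _)             _          (inj₂ ())
    incident-copy (inj₁ _ , inj₂ (u , _))       _          (inj₂ refl) = inj₂ (∈-when (u G.≟ᵥ u) refl)
    incident-copy (inj₂ (u , _) , inj₁ _)       _          (inj₁ refl) = inj₂ (∈-when (u G.≟ᵥ u) refl)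
    incident-copy (inj₂ (u , _) , inj₂ (_ , _)) _          (inj₁ refl) = inj₁ (lose (∈-when (u G.≟ᵥ u) refl) (inj₁ refl))
    incident-copy (inj₂ (u , _) , inj₂ (_ , _)) (refl , _) (inj₂ refl) = inj₁ (lose (∈-when (u G.≟ᵥ u) refl) (inj₂ refl))

  -- A vertex shared by two core edges would be shared in the corona too. This bounds the number of
  -- core edges by the matching number of `G`.
  coreEdges-isMatching : ∀ {N} → IsMatching K N → IsMatching G (coreEdges N)
  coreEdges-isMatching (adj , dis) =
    All.concat⁺ (All.map⁺ (All.map (λ {e} → core-adj e) adj)) ,
    AllPairs.concat⁺ (All.map⁺ (All.universal core-singleton _)) (AllPairs.map⁺ (AllPairs.map core-disjoint dis))

  copyEdges-adj : ∀ {N} u → IsMatching K N → All (uncurry H.Adj) (copyEdges u N)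
  copyEdges-adj u (adj , _) = All.concat⁺ (All.map⁺ (All.map (λ {e} → copy-adj u e) adj))

  saturated-core : ∀ {N u} → IsMatching K N → Saturated K N (inj₁ u) →
                   Saturated G (coreEdges N) u ⊎ ∃[ x ] x ∈ links u N
  saturated-core {u = u} (adj , _) sat with find sat
  ... | e , e∈N , i with incident-core e (All.lookup adj e∈N) i
  ...   | inj₁ p = inj₁ (Any.concatMap⁺ core (lose e∈N p))
  ...   | inj₂ q = let x , _ , p = find q in inj₂ (x , Any.concatMap⁺ (link u) (lose e∈N p))

  saturated-copy : ∀ {N u x} → IsMatching K N → Saturated K N (inj₂ (u , x)) →
                   Saturated H (copyEdges u N) x ⊎ x ∈ links u N
  saturated-copy {u = u} (adj , _) sat with find sat
  ... | e , e∈N , i = Sum.map (Any.concatMap⁺ (copy u) ∘ lose e∈N) (Any.concatMap⁺ (link u) ∘ lose e∈N)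
                              (incident-copy e (All.lookup adj e∈N) i)

  blockSize : List (Pair K) → G.V → ℕ
  blockSize N u = length (copyEdges u N) + length (links u N)

  private
    edgeShare : Pair K → G.V → ℕ
    edgeShare e u = length (copy u e) + length (link u e)

    -- An edge counts either as a core edge or in the block of a single vertex `w`, never twice.
    edgeShare-sum : ∀ e → sum (map (edgeShare e) G.vertices) + length (core e) ≤ 1
    edgeShare-sum (inj₁ _ , inj₁ _)
      rewrite sum-map≡0 {f = λ (_ : G.V) → 0} (All.universal (λ _ → refl) G.vertices) = s≤s z≤n
    edgeShare-sum (inj₁ _ , inj₂ (w , x)) = subst (_≤ 1) (sym (ℕ.+-identityʳ _))
      (sum-map≤1 (vertices-unique G) (λ u → length-when≤1 (u G.≟ᵥ w)) (λ {u} → length-when≡0 (u G.≟ᵥ w)) (G._≟ᵥ w))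
    edgeShare-sum (inj₂ (w , x) , inj₁ _) = subst (_≤ 1) (sym (ℕ.+-identityʳ _))
      (sum-map≤1 (vertices-unique G) (λ u → length-when≤1 (u G.≟ᵥ w)) (λ {u} → length-when≡0 (u G.≟ᵥ w)) (G._≟ᵥ w))
    edgeShare-sum (inj₂ (w , x) , inj₂ _) = subst (_≤ 1) (sym (ℕ.+-identityʳ _))
      (sum-map≤1 (vertices-unique G)
        (λ u → subst (_≤ 1) (sym (ℕ.+-identityʳ _)) (length-when≤1 (u G.≟ᵥ w)))
        (λ {u} u≢w → trans (ℕ.+-identityʳ _) (length-when≡0 (u G.≟ᵥ w) u≢w)) (G._≟ᵥ w))

    blockSize-∷ : ∀ e N u → blockSize (e ∷ N) u ≡ edgeShare e u + blockSize N u
    blockSize-∷ e N u = trans (cong₂ _+_ (List.length-++ (copy u e)) (List.length-++ (link u e)))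
      (interchange (length (copy u e)) _ (length (link u e)) _)

  -- Double counting: the sum over blocks is regrouped edge by edge, and `edgeShare-sum` bounds what
  -- each edge adds.
  blockSize-sum : ∀ N → sum (map (blockSize N) G.vertices) + length (coreEdges N) ≤ length N
  blockSize-sum [] rewrite sum-map≡0 {f = λ (_ : G.V) → 0} (All.universal (λ _ → refl) G.vertices) = z≤n
  blockSize-sum (e ∷ N) = begin
    sum (map (blockSize (e ∷ N)) G.vertices) + length (coreEdges (e ∷ N))
      ≡⟨ cong₂ _+_ (trans (cong sum (List.map-cong (blockSize-∷ e N) G.vertices)) (sum-map-+ (edgeShare e) (blockSize N) G.vertices))
                   (List.length-++ (core e)) ⟩
    (x + y) + (length (core e) + length (coreEdges N))
      ≡⟨ interchange x y (length (core e)) _ ⟩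
    (x + length (core e)) + (y + length (coreEdges N))
      ≤⟨ ℕ.+-mono-≤ (edgeShare-sum e) (blockSize-sum N) ⟩
    suc (length N) ∎
    where
    open ℕ.≤-Reasoning
    x = sum (map (edgeShare e) G.vertices)
    y = sum (map (blockSize N) G.vertices)

  -- Building maximal matchings of a corona.

  private
    coreE : Pair G → Pair K
    coreE (a , b) = inj₁ a , inj₁ b

    linkE : H.V → G.V → Pair K
    linkE x u = inj₁ u , inj₂ (u , x)

    copyE : G.V → Pair H → Pair K
    copyE u (a , b) = inj₂ (u , a) , inj₂ (u , b)

    Within : (K.V → Set) → Pair K → Set
    Within P (a , b) = P a × P b

    -- Reduces disjointness of two groups of edges to disjointness of the vertex regions that
    -- contain their ends.
    within-disjoint : ∀ {P Q : K.V → Set} {xs ys} → (∀ v → P v → ¬ Q v) → All (Within P) xs → All (Within Q) ys →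
                      All (λ e → All (λ f → ¬ ShareVertex K e f) ys) xs
    within-disjoint ¬PQ ps qs = All.map (λ p → All.map (λ { q (v , i , j) → ¬PQ v (at p i) (at q j) }) qs) ps
      where
      at : ∀ {P e v} → Within P e → Incident K v e → P v
      at (p , _) (inj₁ refl) = p
      at (_ , p) (inj₂ refl) = p

  -- One construction serves both residue classes: with `M` empty every vertex of `G` gets a link,
  -- with `M` maximum only those that `M` misses.
  assemble : List (Pair G) → List (Pair H) → H.V → List (Pair K)
  assemble M B x = map coreE M ++ map (linkE x) (filter (λ v → ¬? (saturated? G M v)) G.vertices)
                     ++ concatMap (λ u → map (copyE u) B) G.vertices

  length-assemble : ∀ M B x → length (assemble M B x) ≡ G.order * length B + length M + unsaturatedCount G M
  length-assemble M B x = begin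
    length (assemble M B x)
      ≡⟨ List.length-++ (map coreE M) ⟩
    length (map coreE M) + length (map (linkE x) U ++ copies)
      ≡⟨ cong₂ _+_ (List.length-map coreE M) (trans (List.length-++ (map (linkE x) U)) (cong₂ _+_ (List.length-map (linkE x) U)
           (trans (length-concatMap (λ u → List.length-map (copyE u) B) G.vertices) (cong (_* length B) (length-vertices G))))) ⟩
    length M + (length U + G.order * length B)
      ≡⟨ rotate (length M) (length U) (G.order * length B) ⟩
    G.order * length B + length M + length U ∎
    where
    open ≡-Reasoning
    U = filter (λ v → ¬? (saturated? G M v)) G.vertices
    copies = concatMap (λ u → map (copyE u) B) G.vertices
    rotate : ∀ a b c → a + (b + c) ≡ c + a + b
    rotate = solve-∀

  -- Every core vertex is saturated, by `M` or by its link, so only edges inside copies matter.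
  -- Where `u` is linked, the link covers `x` and near domination suffices. Where `M` saturates `u`,
  -- `B` must dominate alone; for empty `M` that demand is vacuous.
  assemble-isMaximal : ∀ {M B x} → IsMatching G M → IsMatching H B → Unsaturated H B x → NearlyDominating H B x →
    (∀ {u} → Saturated G M u → Dominating H B) → IsMaximalMatching K (assemble M B x)
  assemble-isMaximal {M} {B} {x} (adjM , disM) (adjB , disB) ¬x nearly dominates =
    dominating⇒maximal K (adjacent , disjoint) dominating
    where
    unsat? : ∀ v → Dec (Unsaturated G M v)
    unsat? v = ¬? (saturated? G M v)
    U : List G.V
    U = filter unsat? G.vertices
    copies : G.V → List (Pair K)
    copies u = map (copyE u) B

    adjacent : All (uncurry K.Adj) (assemble M B x)
    adjacent = All.++⁺ (All.map⁺ adjM) (All.++⁺ (All.map⁺ (All.universal (λ _ → refl) U))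
      (All.concat⁺ (All.map⁺ (All.universal (λ u → All.map⁺ (All.map (refl ,_) adjB)) G.vertices))))

    -- Regions for the ends of core edges, links and copy edges. The last two are disjoint because
    -- `B` misses `x`.
    R₁ R₂ R₃ : K.V → Set
    R₁ (inj₁ u)       = Saturated G M u
    R₁ (inj₂ _)       = ⊥
    R₂ (inj₁ u)       = Unsaturated G M u
    R₂ (inj₂ (_ , y)) = y ≡ x
    R₃ (inj₁ _)       = ⊥
    R₃ (inj₂ (_ , y)) = Saturated H B y

    InCopy : G.V → K.V → Set
    InCopy u (inj₁ _)       = ⊥
    InCopy u (inj₂ (w , _)) = w ≡ u

    within₁ : All (Within R₁) (map coreE M)
    within₁ = All.map⁺ (All.tabulate λ e∈ → lose e∈ (inj₁ refl) , lose e∈ (inj₂ refl))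
    within₂ : All (Within R₂) (map (linkE x) U)
    within₂ = All.map⁺ (All.tabulate λ u∈ → proj₂ (∈-filter⁻ unsat? {xs = G.vertices} u∈) , refl)
    within₃ : All (Within R₃) (concatMap copies G.vertices)
    within₃ = All.concat⁺ (All.map⁺ (All.universal (λ u → All.map⁺ (All.tabulate λ e∈ → lose e∈ (inj₁ refl) , lose e∈ (inj₂ refl))) G.vertices))
    within-copy : ∀ u → All (Within (InCopy u)) (copies u)
    within-copy u = All.map⁺ (All.universal (λ _ → refl , refl) B)

    disjoint : AllPairs (λ e f → ¬ ShareVertex K e f) (assemble M B x)
    disjoint = AllPairs.++⁺ core-part (AllPairs.++⁺ link-part copy-part
        (within-disjoint (λ { (inj₁ _) _ () ; (inj₂ _) refl sat → ¬x sat }) within₂ within₃))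
      -- Core edges are compared with links and copy edges at once, through the union of their
      -- regions.
      (within-disjoint {Q = λ v → R₂ v ⊎ R₃ v}
        (λ { (inj₁ _) sat (inj₁ ¬sat) → ¬sat sat ; (inj₁ _) _ (inj₂ ()) ; (inj₂ _) () _ })
        within₁ (All.++⁺ (All.map (λ (p , q) → inj₁ p , inj₁ q) within₂) (All.map (λ (p , q) → inj₂ p , inj₂ q) within₃)))
      where
      core-part : AllPairs (λ e f → ¬ ShareVertex K e f) (map coreE M)
      core-part = AllPairs.map⁺ (AllPairs.map (λ ¬sh → λ
        { (_ , inj₁ refl , inj₁ refl) → ¬sh (_ , inj₁ refl , inj₁ refl)
        ; (_ , inj₁ refl , inj₂ refl) → ¬sh (_ , inj₁ refl , inj₂ refl)
        ; (_ , inj₂ refl , inj₁ refl) → ¬sh (_ , inj₂ refl , inj₁ refl)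
        ; (_ , inj₂ refl , inj₂ refl) → ¬sh (_ , inj₂ refl , inj₂ refl) }) disM)
      link-part : AllPairs (λ e f → ¬ ShareVertex K e f) (map (linkE x) U)
      link-part = AllPairs.map⁺ (AllPairs.map (λ u≢w → λ
        { (_ , inj₁ refl , inj₁ refl) → u≢w refl
        ; (_ , inj₁ refl , inj₂ ())
        ; (_ , inj₂ refl , inj₁ ())
        ; (_ , inj₂ refl , inj₂ refl) → u≢w refl }) (Unique.filter⁺ unsat? (vertices-unique G)))
      one-copy : ∀ u → AllPairs (λ e f → ¬ ShareVertex K e f) (copies u)
      one-copy u = AllPairs.map⁺ (AllPairs.map (λ ¬sh → λ
        { (_ , inj₁ refl , inj₁ refl) → ¬sh (_ , inj₁ refl , inj₁ refl)
        ; (_ , inj₁ refl , inj₂ refl) → ¬sh (_ , inj₁ refl , inj₂ refl)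
        ; (_ , inj₂ refl , inj₁ refl) → ¬sh (_ , inj₂ refl , inj₁ refl)
        ; (_ , inj₂ refl , inj₂ refl) → ¬sh (_ , inj₂ refl , inj₂ refl) }) disB)
      copy-part : AllPairs (λ e f → ¬ ShareVertex K e f) (concatMap copies G.vertices)
      copy-part = AllPairs.concat⁺ (All.map⁺ (All.universal one-copy G.vertices))
        (AllPairs.map⁺ (AllPairs.map (λ {u} {w} u≢w →
          within-disjoint (λ { (inj₁ _) () _ ; (inj₂ _) refl p → u≢w p }) (within-copy u) (within-copy w)) (vertices-unique G)))

    link-saturates : ∀ {u v} → Unsaturated G M u → Incident K v (linkE x u) → Saturated K (assemble M B x) v
    link-saturates {u} ¬sat i = Any.++⁺ʳ (map coreE M) (Any.++⁺ˡ
      (Any.map⁺ (lose (∈-filter⁺ unsat? (∈-vertices G u) ¬sat) i)))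
    core-saturated : ∀ u → Saturated K (assemble M B x) (inj₁ u)
    core-saturated u with saturated? G M u
    ... | yes sat = Any.++⁺ˡ (Any.map⁺ (Any.map incident-inj₁ sat))
    ... | no ¬sat = link-saturates ¬sat (inj₁ refl)
    copy-saturated : ∀ u {y} → Saturated H B y → Saturated K (assemble M B x) (inj₂ (u , y))
    copy-saturated u sat = Any.++⁺ʳ (map coreE M) (Any.++⁺ʳ (map (linkE x) U) (Any.concatMap⁺ copies
      (lose (∈-vertices G u) (Any.map⁺ (Any.map (Sum.map (cong (λ y → inj₂ (u , y))) (cong (λ y → inj₂ (u , y)))) sat)))))

    dominating : Dominating K (assemble M B x)
    dominating (inj₁ u)       _              _          = inj₁ (core-saturated u)
    dominating (inj₂ _)       (inj₁ w)       _          = inj₂ (core-saturated w)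
    dominating (inj₂ (u , y)) (inj₂ (_ , z)) (refl , a) with saturated? G M u
    ... | yes sat = Sum.map (copy-saturated u) (copy-saturated u) (dominates sat y z a)
    ... | no ¬sat with nearly y z a
    ...   | inj₁ p           = Sum.map (copy-saturated u) (copy-saturated u) p
    ...   | inj₂ (inj₁ refl) = inj₁ (link-saturates ¬sat (inj₂ refl))
    ...   | inj₂ (inj₂ refl) = inj₂ (link-saturates ¬sat (inj₂ refl))

-- Lower bounds for the corona with a cycle, and the two formulas.

module _ (G : SimpleGraph) (m : ℕ) (m≥3 : 3 ≤ m) where
  private
    module G = SimpleGraph G

    C : SimpleGraph
    C = cycle m m≥3

    K : SimpleGraph
    K = corona G C

    t : ℕ
    t = m / 3

  module _ {N} (max : IsMaximalMatching K N) where
    private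
      mat : IsMatching K N
      mat = proj₁ max

      b ℓ : G.V → ℕ
      b u = length (copyEdges G C u N)
      ℓ u = length (links G C u N)

    -- Maximality dominates each edge of the copy of `u`, and a copy vertex can be covered only by a
    -- copy edge or a link: the covering bound applies with the links as outside cover.
    m≤3*copyEdges+2*links : ∀ u → m ≤ 3 * b u + 2 * ℓ u
    m≤3*copyEdges+2*links u = m≤3*length+2*length m m≥3 (copyEdges-adj G C u mat) λ n →
      Sum.map (saturated-copy G C mat) (saturated-copy G C mat)
              (maximal⇒dominating K max (inj₂ (u , _)) (inj₂ (u , _)) (refl , inj₁ n))

    -- With `u` uncovered, every edge from `u` to its copy must be dominated at the copy end, and
    -- without links only copy edges can do that.
    unsaturated⇒m≤2*copyEdges : ∀ u → links G C u N ≡ [] → Unsaturated G (coreEdges G C N) u → m ≤ 2 * b u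
    unsaturated⇒m≤2*copyEdges u no-links ¬sat = m≤2*length m m≥3 λ v →
      [ (λ p → ⊥-elim ([ ¬sat , (λ (_ , x∈) → no-link x∈) ]′ (saturated-core G C mat p)))
      , (λ p → [ (λ q → q) , (λ x∈ → ⊥-elim (no-link x∈)) ]′ (saturated-copy G C mat p)) ]′
      (maximal⇒dominating K max (inj₁ u) (inj₂ (u , v)) refl)
      where
      no-link : ∀ {x} → ¬ x ∈ links G C u N
      no-link {x} x∈ with subst (x ∈_) no-links x∈
      ... | ()

    m%3≢0⇒m/3<blockSize : m % 3 ≢ 0 → ∀ u → m / 3 < blockSize G C N u
    m%3≢0⇒m/3<blockSize m%3≢0 u = ℕ.*-cancelˡ-< 3 t (b u + ℓ u) (begin-strict
      3 * t               <⟨ m%3≢0⇒3*[m/3]<m m m≥3 m%3≢0 ⟩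
      m                   ≤⟨ m≤3*copyEdges+2*links u ⟩
      3 * b u + 2 * ℓ u   ≤⟨ ℕ.+-monoʳ-≤ (3 * b u) (ℕ.*-monoˡ-≤ (ℓ u) (ℕ.n≤1+n 2)) ⟩
      3 * b u + 3 * ℓ u   ≡⟨ ℕ.*-distribˡ-+ 3 (b u) (ℓ u) ⟨
      3 * (b u + ℓ u)     ∎)
      where open ℕ.≤-Reasoning

    -- The indicator makes up for the one edge by which the block of a core-saturated vertex may
    -- fall short.
    m%3≡0⇒m/3<blockSize+saturated : m % 3 ≡ 0 → ∀ u →
      m / 3 < blockSize G C N u + indicator (saturated? G (coreEdges G C N) u)
    m%3≡0⇒m/3<blockSize+saturated m%3≡0 u
      with links G C u N in eq | m≤3*copyEdges+2*links u | saturated? G (coreEdges G C N) u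
    -- A link makes the bound strict, since it accounts for two vertices rather than three.
    ... | x ∷ xs | m≤ | sat? = ℕ.<-≤-trans (ℕ.*-cancelˡ-< 3 t (b u + suc (length xs)) (begin-strict
      3 * t                                  ≡⟨ 3*t≡m ⟩
      m                                      ≤⟨ m≤ ⟩
      3 * b u + 2 * suc (length xs)          <⟨ ℕ.+-monoʳ-< (3 * b u) (ℕ.*-monoˡ-< (suc (length xs)) (ℕ.n<1+n 2)) ⟩
      3 * b u + 3 * suc (length xs)          ≡⟨ ℕ.*-distribˡ-+ 3 (b u) (suc (length xs)) ⟨
      3 * (b u + suc (length xs))            ∎)) (ℕ.m≤m+n _ _)
      where
      open ℕ.≤-Reasoning
      3*t≡m : 3 * t ≡ m
      3*t≡m = m%3≡0⇒3*[m/3]≡m m m≥3 m%3≡0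
    -- Only `t ≤ b` is available here; the indicator supplies the missing one.
    ... | [] | m≤ | yes _ = subst (t <_) (sym (trans (cong (_+ 1) (ℕ.+-identityʳ (b u))) (ℕ.+-comm (b u) 1)))
      (s≤s (ℕ.*-cancelˡ-≤ 3 (ℕ.≤-trans (ℕ.≤-reflexive (m%3≡0⇒3*[m/3]≡m m m≥3 m%3≡0)) (subst (m ≤_) (ℕ.+-identityʳ _) m≤))))
    -- `u` is uncovered, so `m ≤ 2b`; as `m` is positive, so is `b`, and `2b < 3b`.
    ... | [] | m≤ | no ¬sat = subst (t <_) (sym (trans (ℕ.+-identityʳ _) (ℕ.+-identityʳ (b u))))
      (ℕ.*-cancelˡ-< 3 t (b u) (begin-strict
        3 * t     ≡⟨ m%3≡0⇒3*[m/3]≡m m m≥3 m%3≡0 ⟩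
        m         ≤⟨ m≤2b ⟩
        2 * b u   <⟨ 2*b<3*b (b u) m≤2b ⟩
        3 * b u   ∎))
      where
      open ℕ.≤-Reasoning
      m≤2b : m ≤ 2 * b u
      m≤2b = unsaturated⇒m≤2*copyEdges u eq ¬sat
      2*b<3*b : ∀ k → m ≤ 2 * k → 2 * k < 3 * k
      2*b<3*b zero    m≤0 = ⊥-elim (ℕ.n≮0 (ℕ.≤-trans m≥3 m≤0))
      2*b<3*b (suc k) _   = ℕ.*-monoˡ-< (suc k) (ℕ.n<1+n 2)

    m%3≢0⇒order*≤length : m % 3 ≢ 0 → G.order * suc (m / 3) ≤ length N
    m%3≢0⇒order*≤length m%3≢0 = begin
      G.order * suc t                                      ≡⟨ cong (_* suc t) (length-vertices G) ⟨
      length G.vertices * suc t                            ≤⟨ length*≤sum-map (m%3≢0⇒m/3<blockSize m%3≢0) G.vertices ⟩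
      sum (map (blockSize G C N) G.vertices)               ≤⟨ ℕ.m≤m+n _ _ ⟩
      sum (map (blockSize G C N) G.vertices) + length (coreEdges G C N)
                                                           ≤⟨ blockSize-sum G C N ⟩
      length N                                             ∎
      where open ℕ.≤-Reasoning

    m%3≡0⇒order*≤length+coreEdges : m % 3 ≡ 0 → G.order * suc (m / 3) ≤ length N + length (coreEdges G C N)
    m%3≡0⇒order*≤length+coreEdges m%3≡0 = begin
      G.order * suc t                      ≡⟨ cong (_* suc t) (length-vertices G) ⟨
      length G.vertices * suc t            ≤⟨ length*≤sum-map (m%3≡0⇒m/3<blockSize+saturated m%3≡0) G.vertices ⟩
      sum (map (λ u → blockSize G C N u + indicator (saturated? G core′ u)) G.vertices)
                                           ≡⟨ sum-map-+ (blockSize G C N) (indicator ∘ saturated? G core′) G.vertices ⟩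
      Σb + sum (map (indicator ∘ saturated? G core′) G.vertices)
                                           ≡⟨ cong (Σb +_) (sum-indicator (saturated? G core′) G.vertices) ⟩
      Σb + length (saturatedVertices G core′)
                                           ≤⟨ ℕ.+-monoʳ-≤ Σb (saturatedVertices≤ G core′) ⟩
      -- A core edge relieves two blocks but is itself an edge of `N`, so the net saving is one per
      -- core edge.
      Σb + 2 * length core′                ≡⟨ regroup Σb (length core′) ⟩
      (Σb + length core′) + length core′   ≤⟨ ℕ.+-monoˡ-≤ (length core′) (blockSize-sum G C N) ⟩
      length N + length core′              ∎
      where
      open ℕ.≤-Reasoning
      core′ = coreEdges G C N
      Σb = sum (map (blockSize G C N) G.vertices)
      regroup : ∀ x y → x + 2 * y ≡ (x + y) + y
      regroup = solve-∀

  s-corona-m%3≢0 : m % 3 ≢ 0 → s K ≡ G.order * s C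
  s-corona-m%3≢0 m%3≢0 rewrite m%3≢0⇒s≡1+m/3 m m≥3 m%3≢0 with sparse-nearlyDominating m m≥3 m%3≢0
  ... | x , ¬x , nearly = s≡ K
    -- The empty core matching leaves all `n` vertices to be linked, which gives `nt + n` edges.
    (assemble G C [] B x , assemble-isMaximal G C ([] , []) (sparse-isMatching m m≥3) ¬x nearly (λ ()) , size)
    λ N max → m%3≢0⇒order*≤length max m%3≢0
    where
    B : List (Pair C)
    B = sparse m m≥3
    size : length (assemble G C [] B x) ≡ G.order * suc t
    size = begin
      length (assemble G C [] B x)                              ≡⟨ length-assemble G C [] B x ⟩
      G.order * length B + 0 + unsaturatedCount G []            ≡⟨ cong₂ _+_ (ℕ.+-identityʳ (G.order * length B))
                                                                     (sym (order≡2*length+unsaturated G {[]} ([] , []))) ⟩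
      G.order * length B + G.order                              ≡⟨ cong (λ k → G.order * k + G.order) (length-sparse m m≥3) ⟩
      G.order * t + G.order                                     ≡⟨ ℕ.+-comm (G.order * t) G.order ⟩
      G.order + G.order * t                                     ≡⟨ ℕ.*-suc G.order t ⟨
      G.order * suc t                                           ∎
      where open ≡-Reasoning

  s-corona-m%3≡0 : ∀ {M} → IsMaximumMatching G M → m % 3 ≡ 0 →
                   s K ≡ G.order * s C + length M + unsaturatedCount G M
  s-corona-m%3≡0 {M} (mat , maximum) m%3≡0
    rewrite m%3≡0⇒s≡m/3 m m≥3 m%3≡0 with sparse-unsaturated m m≥3
  ... | x , ¬x = s≡ K
    ( assemble G C M B x
    -- `sparse` already dominates the cycle, so any vertex it misses can receive the links.
    , assemble-isMaximal G C mat (sparse-isMatching m m≥3) ¬x (λ u v a → inj₁ (dom u v a)) (λ _ → dom)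
    , trans (length-assemble G C M B x) (cong (λ k → G.order * k + length M + l) (length-sparse m m≥3)))
    -- Adding `length M` on the left turns `length M + l` into `n`; on the right it bounds the
    -- number of core edges of `N`, since `M` is maximum.
    λ N max → ℕ.+-cancelʳ-≤ (length M) _ _ (begin
      G.order * t + length M + l + length M    ≡⟨ regroup (G.order * t) (length M) l ⟩
      (2 * length M + l) + G.order * t         ≡⟨ cong (_+ G.order * t) (order≡2*length+unsaturated G mat) ⟨
      G.order + G.order * t                    ≡⟨ ℕ.*-suc G.order t ⟨
      G.order * suc t                          ≤⟨ m%3≡0⇒order*≤length+coreEdges max m%3≡0 ⟩
      length N + length (coreEdges G C N)      ≤⟨ ℕ.+-monoʳ-≤ (length N) (maximum _ (coreEdges-isMatching G C (proj₁ max))) ⟩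
      length N + length M                      ∎)
    where
    open ℕ.≤-Reasoning
    B : List (Pair C)
    B = sparse m m≥3
    dom : Dominating C B
    dom = sparse-dominating m m≥3 m%3≡0
    l : ℕ
    l = unsaturatedCount G M
    regroup : ∀ x a l → x + a + l + a ≡ (2 * a + l) + x
    regroup = solve-∀

theorem2p5 : (G : SimpleGraph) (m : ℕ) (m≥3 : 3 ≤ m) (M : List (Pair G)) → IsMaximumMatching G M →
    let n = SimpleGraph.order G
        l = unsaturatedCount G M
        C = cycle m m≥3
    in (n ≡ 2 * α′ G + l)
       × (m % 3 ≡ 0 → s (corona G C) ≡ n * s C + α′ G + l)
       × (m % 3 ≢ 0 → s (corona G C) ≡ n * s C)
-- `α′ G` comes from its own choice of a maximum matching; the rewrite replaces it by the size of
-- the given `M`.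
theorem2p5 G m m≥3 M maximum rewrite α′≡ G maximum =
  order≡2*length+unsaturated G (proj₁ maximum) , s-corona-m%3≡0 G m m≥3 maximum , s-corona-m%3≢0 G m m≥3
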